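{- Let $p$ be an odd prime, $\ell\geq1$, $k\geq1$. Then $|\mathcal{C}_{k+1}((\mathbb{Z}/p^\ell\mathbb{Z})^2)|\approx (p^\ell)^{2k-1}$. More precisely, the good $(k+1)$-point configurations in $(\mathbb{Z}/p^\ell\mathbb{Z})^2$ determine $\approx(p^\ell)^{2k-1}$ equivalence classes, and the bad configurations determine $o((p^\ell)^{2k-1})$ equivalence classes.
   Context: For $R=\mathbb{Z}/p^\ell\mathbb{Z}$ and $x=(x_1,x_2),y=(y_1,y_2)\in R^2$, write $y^\perp=(y_2,-y_1)$, so $x\cdot y^\perp=x_1y_2-x_2y_1$. A $(k+1)$-point configuration is $x=(x^1,\dots,x^{k+1})\in(R^2)^{k+1}$; it is good if $x^i\cdot x^{j\perp}$ is a unit for some $i,j$, and bad otherwise. Two configurations $x,y$ are equivalent iff $x^i\cdot x^{j\perp}=y^i\cdot y^{j\perp}$ for all pairs $i,j$; $\mathcal{C}_{k+1}(R^2)$ is the set of equivalence classes (and goodness/badness is constant on classes). $X\approx Y$ means $C^{ -1}Y\leq X\leq CY$ with $C$ independent of $p$ and $\ell$ (possibly depending on $k$); $o(Y)$ denotes a quantity whose ratio to $Y$ tends to $0$ as $p\to\infty$. -}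

module Defs where

open import Algebra.Definitions using (Invertible)
open import Data.Fin.Base using (Fin; toℕ)
open import Data.Fin.Properties using (_≟_; all?; any?; nonZeroIndex)
open import Data.Integer.Base using (+_)
open import Data.List.Base
  using (List; []; _∷_; allFin; cartesianProduct; cartesianProductWith;
         deduplicate; filter; length)
open import Data.Nat.Base as ℕ using (ℕ; zero; suc)
open import Data.Nat.DivMod using (_mod_)
open import Data.Nat.Primality using (Prime)
open import Data.Product.Base using (_×_; _,_; ∃-syntax)
open import Data.Rational.Base as ℚ using (ℚ; 0ℚ)
open import Data.Vec.Base using (Vec; []; _∷_; lookup)
open import Relation.Binary.PropositionalEquality using (_≡_; _≢_)
open import Relation.Nullary.Decidable using (Dec; ¬?; _×-dec_)
open import Relation.Nullary.Negation using (¬_)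

-- ℤ/nℤ is Fin n, each class being represented by its least nonnegative
-- residue.  An element of Fin n witnesses that n is nonzero.
infixl 7 _*_
infixl 6 _-_

_*_ : ∀ {n} → Fin n → Fin n → Fin n
_*_ {n} a b = _mod_ (toℕ a ℕ.* toℕ b) n {{nonZeroIndex a}}

-- The truncated subtraction is exact, because toℕ b < n.
_-_ : ∀ {n} → Fin n → Fin n → Fin n
_-_ {n} a b = _mod_ (toℕ a ℕ.+ (n ℕ.∸ toℕ b)) n {{nonZeroIndex a}}

Unit : ∀ {n} → Fin n → Set
Unit {n} a = Invertible _≡_ (_mod_ 1 n {{nonZeroIndex a}}) _*_ a

unit? : ∀ {n} (a : Fin n) → Dec (Unit a)
unit? a = any? λ b → (b * a ≟ _) ×-dec (a * b ≟ _)

Point : ℕ → Set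
Point n = Fin n × Fin n

-- x ·⊥ y is x · y^⊥, where y^⊥ = (y₂ , - y₁).
infix 8 _·⊥_
_·⊥_ : ∀ {n} → Point n → Point n → Fin n
(x₁ , x₂) ·⊥ (y₁ , y₂) = x₁ * y₂ - x₂ * y₁

Config : (k n : ℕ) → Set
Config k n = Vec (Point n) (suc k)

module _ {k n : ℕ} where

  Good : Config k n → Set
  Good x = ∃[ i ] ∃[ j ] Unit (lookup x i ·⊥ lookup x j)

  Bad : Config k n → Set
  Bad x = ¬ Good x

  infix 4 _∼_ _∼?_
  _∼_ : Config k n → Config k n → Set
  x ∼ y = ∀ i j → lookup x i ·⊥ lookup x j ≡ lookup y i ·⊥ lookup y j

  good? : (x : Config k n) → Dec (Good x)
  good? x = any? λ i → any? λ j → unit? (lookup x i ·⊥ lookup x j)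

  bad? : (x : Config k n) → Dec (Bad x)
  bad? x = ¬? (good? x)

  _∼?_ : (x y : Config k n) → Dec (x ∼ y)
  x ∼? y = all? λ i → all? λ j →
    lookup x i ·⊥ lookup x j ≟ lookup y i ·⊥ lookup y j

  -- Deduplication keeps exactly one member of each class meeting the list.
  classCount : List (Config k n) → ℕ
  classCount xs = length (deduplicate _∼?_ xs)

allVecs : {A : Set} → List A → (m : ℕ) → List (Vec A m)
allVecs xs zero    = [] ∷ []
allVecs xs (suc m) = cartesianProductWith _∷_ xs (allVecs xs m)

allConfigs : (k n : ℕ) → List (Config k n)
allConfigs k n = allVecs (cartesianProduct (allFin n) (allFin n)) (suc k)

#𝒞 : (k n : ℕ) → ℕ
#𝒞 k n = classCount (allConfigs k n)

#𝒞-good : (k n : ℕ) → ℕ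
#𝒞-good k n = classCount (filter good? (allConfigs k n))

#𝒞-bad : (k n : ℕ) → ℕ
#𝒞-bad k n = classCount (filter bad? (allConfigs k n))

OddPrime : ℕ → Set
OddPrime p = Prime p × p ≢ 2

-- X ≈ Y compares quantities depending on an odd prime p and on ℓ ≥ 1:
-- C⁻¹ Y ≤ X ≤ C Y with C independent of p and ℓ.  Since enlarging C is
-- harmless, C may be taken to be a positive integer.
infix 4 _≈_
_≈_ : (X Y : ℕ → ℕ → ℕ) → Set
X ≈ Y = ∃[ C ] 1 ℕ.≤ C × (∀ p ℓ → OddPrime p → 1 ℕ.≤ ℓ →
  Y p ℓ ℕ.≤ C ℕ.* X p ℓ × X p ℓ ℕ.≤ C ℕ.* Y p ℓ)

ℕ→ℚ : ℕ → ℚ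
ℕ→ℚ m = + m ℚ./ 1

-- X / Y → 0 as the odd prime p → ∞, uniformly in ℓ ≥ 1.
IsLittleO : (X Y : ℕ → ℕ → ℕ) → Set
IsLittleO X Y = ∀ (ε : ℚ) → 0ℚ ℚ.< ε → ∃[ P ] ∀ p ℓ → OddPrime p → 1 ℕ.≤ ℓ →
  P ℕ.≤ p → ℕ→ℚ (X p ℓ) ℚ.≤ ε ℚ.* ℕ→ℚ (Y p ℓ)

{-# OPTIONS --safe #-}
-- Divisibility is total in ℤ/p^ℓℤ, so some coordinate d of a configuration divides all the
-- others.  SL₂ moves the point it belongs to to (d,0), and then diag(d⁻¹,d), applied formally
-- because d need not be a unit, moves it to (1,0) without changing any product; the other
-- points become (aⱼ,bⱼ), where bⱼ is itself one of the products.  A shear along a point whose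
-- bⱼ divides all the others clears its aⱼ.  So with n = p^ℓ every class has one of
-- (k+1) k n^(2k-1) normal forms, and for a bad class all k of the bⱼ are multiples of p, which
-- saves a factor of at least p.  Conversely, extending (1,0), (0,u), u a unit, by arbitrary
-- points gives pairwise inequivalent good configurations, and at least n/2 elements are units.
module Submission where

open import Defs
  using (Unit; unit?; Point; _·⊥_; Config; Good; _∼_; good?; bad?; _∼?_;
         classCount; allVecs; allConfigs; OddPrime; ℕ→ℚ;
         #𝒞; #𝒞-good; #𝒞-bad; _≈_; IsLittleO)
  renaming (_*_ to _*ᶠ_; _-_ to _-ᶠ_)
open import Data.Bool.Base using (Bool; true; false)
open import Data.Fin.Base using (Fin; zero; suc; toℕ; punchIn; punchOut; fromℕ<)
open import Data.Fin.Properties as Fin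
  using (toℕ<n; toℕ-injective; toℕ-fromℕ<; nonZeroIndex; punchIn-punchOut; punchInᵢ≢i)
open import Data.Integer.Base using (ℤ; +_; -[1+_]; 0ℤ; 1ℤ; ∣_∣; +≤+; +<+)
  renaming (_+_ to _+ᶻ_; _*_ to _*ᶻ_; _-_ to _-ᶻ_; _≤_ to _≤ᶻ_)
open import Data.Integer.DivMod using (a≡a%ℕn+[a/ℕn]*n) renaming (_%ℕ_ to _%ᶻ_; _/ℕ_ to _/ᶻ_)
open import Data.Integer.Divisibility.Signed
  using (_∣_; divides; _∣?_; ∣ᵤ⇒∣; ∣⇒∣ᵤ; ∣-refl; ∣m∣n⇒∣m+n; ∣m∣n⇒∣m-n; ∣m⇒∣m*n; ∣n⇒∣m*n;
         m∣∣m∣; *-monoʳ-∣)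
import Data.Integer.Properties as ℤ
open import Data.Integer.Tactic.RingSolver using (solve-∀)
open import Data.List.Base as List
  using (List; []; _∷_; allFin; cartesianProduct; cartesianProductWith; filter;
         length; map)
open import Data.List.Membership.Propositional using (_∈_; lose)
open import Data.List.Membership.Propositional.Properties
  using (∈-allFin; ∈-cartesianProductWith⁺; ∈-cartesianProduct⁺; ∈-deduplicate⁻;
         ∈-cartesianProduct⁻; ∈-filter⁺; ∈-filter⁻; ∈-lookup; ∈-map⁺; ∈-map⁻)
open import Data.List.Properties using (length-map; length-tabulate; length-++)
open import Data.List.Relation.Unary.All as All using (All; []; _∷_)
open import Data.List.Relation.Unary.AllPairs using ([]; _∷_)
open import Data.List.Relation.Unary.Any as Any using (Any; here; there; index)
import Data.List.Relation.Unary.All.Properties as All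
import Data.List.Relation.Unary.Any.Properties as Any
import Data.List.Relation.Unary.Unique.DecSetoid.Properties as DecUnique
open import Data.List.Relation.Unary.Unique.Propositional using (Unique)
import Data.List.Relation.Unary.Unique.Propositional.Properties as Unique
import Data.List.Relation.Unary.Unique.Setoid as SetoidUnique
open import Data.Nat.Base as ℕ
  using (ℕ; zero; suc; NonZero; _≤_; _<_; z≤n; s≤s; _+_; _^_; _*_; _∸_)
open import Data.Nat.Coprimality using (coprime-Bézout; Coprime)
import Data.Nat.Divisibility as ℕ∣
open import Data.Nat.DivMod using (_mod_; m≡m%n+[m/n]*n; m%n<n; _%_; _/_)
open import Data.Nat.GCD using (module Bézout)
open import Data.Nat.Primality using (Prime; prime⇒irreducible; prime⇒nonZero; prime⇒nonTrivial)
import Data.Nat.Properties as ℕ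
open import Data.Nat.Tactic.RingSolver using () renaming (solve-∀ to ℕ-solve-∀)
open import Data.Product.Base using (_×_; _,_; proj₁; proj₂; ∃-syntax)
open import Data.Rational.Base as ℚ using (ℚ; mkℚ; 0ℚ; toℚᵘ)
import Data.Rational.Properties as ℚ
import Data.Rational.Unnormalised.Base as ℚᵘ
import Data.Rational.Unnormalised.Properties as ℚᵘ
open import Data.Sum.Base using (_⊎_; inj₁; inj₂)
open import Data.Vec.Base using (Vec; []; _∷_; lookup; tabulate; insertAt)
import Data.Vec.Properties as Vec
open import Level using (0ℓ)
open import Relation.Binary.Bundles using (Setoid; DecSetoid)
open import Relation.Nullary using (¬_; contradiction; yes; no)
open import Relation.Binary.PropositionalEquality
  using (_≡_; _≢_; refl; sym; trans; cong; cong₂; subst; setoid; module ≡-Reasoning)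

-- Arithmetic of ℤ/nℤ through integer representatives

infix 4 _represents_

-- Fin n is ℤ/nℤ, so an identity between elements of Fin n is proved by evaluating
-- both sides at representatives in ℤ, where the ring solver applies.
record _represents_ {n} (x : ℤ) (a : Fin n) : Set where
  constructor congruent
  field divides-difference : + n ∣ x -ᶻ + toℕ a

⟦_⟧ : ∀ {n} (a : Fin n) → + toℕ a represents a
⟦ a ⟧ = congruent (divides 0ℤ (ℤ.+-inverseʳ (+ toℕ a)))

represents-cong : ∀ {n x y} {a : Fin n} → + n ∣ x -ᶻ y → y represents a → x represents a
represents-cong {n} {x} {y} {a} p (congruent q) =
  congruent (subst (+ n ∣_) (identity x y (+ toℕ a)) (∣m∣n⇒∣m+n p q))
  where
  identity : ∀ x y z → x -ᶻ y +ᶻ (y -ᶻ z) ≡ x -ᶻ z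
  identity = solve-∀

mod-represents : ∀ m n .{{_ : NonZero n}} → + m represents (m mod n)
mod-represents m n = congruent (divides (+ (m / n)) (begin
  + m -ᶻ + toℕ (m mod n)
    ≡⟨ cong₂ (λ u v → + u -ᶻ + v) (m≡m%n+[m/n]*n m n) (toℕ-fromℕ< (m%n<n m n)) ⟩
  + (r + q * n) -ᶻ + r
    ≡⟨ cong (_-ᶻ + r) (trans (ℤ.pos-+ r _) (cong (λ z → + r +ᶻ z) (ℤ.pos-* q n))) ⟩
  + r +ᶻ + q *ᶻ + n -ᶻ + r
    ≡⟨ identity (+ r) (+ q *ᶻ + n) ⟩
  + q *ᶻ + n ∎))
  where
  open ≡-Reasoning
  r = m % n
  q = m / n
  identity : ∀ x y → x +ᶻ y -ᶻ x ≡ y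
  identity = solve-∀

infixl 7 _*ʳ_
infixl 6 _-ʳ_

_*ʳ_ : ∀ {n x y} {a b : Fin n} → x represents a → y represents b → x *ᶻ y represents a *ᶠ b
_*ʳ_ {n} {x} {y} {a} {b} (congruent p) (congruent q) =
  represents-cong
    (subst (+ n ∣_)
      (trans (identity x y A B) (cong (λ z → x *ᶻ y -ᶻ z) (sym (ℤ.pos-* (toℕ a) (toℕ b)))))
      (∣m∣n⇒∣m+n (∣m⇒∣m*n y p) (∣n⇒∣m*n A q)))
    (mod-represents (toℕ a * toℕ b) n {{nonZeroIndex a}})
  where
  A = + toℕ a
  B = + toℕ b
  identity : ∀ x y a b → (x -ᶻ a) *ᶻ y +ᶻ a *ᶻ (y -ᶻ b) ≡ x *ᶻ y -ᶻ a *ᶻ b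
  identity = solve-∀

_-ʳ_ : ∀ {n x y} {a b : Fin n} → x represents a → y represents b → x -ᶻ y represents a -ᶠ b
_-ʳ_ {n} {x} {y} {a} {b} (congruent p) (congruent q) =
  represents-cong
    (subst (+ n ∣_)
      (trans (identity x y A B (+ n)) (cong (λ z → x -ᶻ y -ᶻ z) (sym truncated)))
      -- `_-ᶠ_` computes a + (n - b), which exceeds a - b by n; the extra n is removed here.
      (∣m∣n⇒∣m-n (∣m∣n⇒∣m-n p q) (∣-refl {+ n})))
    (mod-represents (toℕ a + (n ∸ toℕ b)) n {{nonZeroIndex a}})
  where
  A = + toℕ a
  B = + toℕ b
  truncated : + (toℕ a + (n ∸ toℕ b)) ≡ A +ᶻ (+ n -ᶻ B)
  truncated = trans (ℤ.pos-+ (toℕ a) _) (cong (λ z → A +ᶻ z)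
    (sym (trans (ℤ.m-n≡m⊖n n (toℕ b)) (ℤ.⊖-≥ (ℕ.<⇒≤ (toℕ<n b))))))
  identity : ∀ x y a b n → x -ᶻ a -ᶻ (y -ᶻ b) -ᶻ n ≡ x -ᶻ y -ᶻ (a +ᶻ (n -ᶻ b))
  identity = solve-∀

-- Both residues lie in [0,n), so their difference is below n in absolute value; being a multiple of
-- n, it is 0.
represents-unique : ∀ {n x} {a b : Fin n} → x represents a → x represents b → a ≡ b
represents-unique {n} {x} {a} {b} (congruent p) (congruent q) =
  toℕ-injective (ℤ.+-injective (ℤ.i-j≡0⇒i≡j A B (ℤ.∣i∣≡0⇒i≡0 vanishes)))
  where
  A = + toℕ a
  B = + toℕ b
  identity : ∀ x a b → x -ᶻ b -ᶻ (x -ᶻ a) ≡ a -ᶻ b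
  identity = solve-∀
  n∣A-B : + n ∣ A -ᶻ B
  n∣A-B = subst (+ n ∣_) (identity x A B) (∣m∣n⇒∣m-n q p)
  bound : ∣ A -ᶻ B ∣ < n
  bound = ℕ.≤-<-trans
    (ℕ.≤-trans (ℕ.≤-reflexive (cong ∣_∣ (ℤ.m-n≡m⊖n (toℕ a) (toℕ b))))
               (ℤ.∣m⊝n∣≤m⊔n (toℕ a) (toℕ b)))
    (ℕ.⊔-lub (toℕ<n a) (toℕ<n b))
  vanishes : ∣ A -ᶻ B ∣ ≡ 0
  vanishes with ∣ A -ᶻ B ∣ | ∣⇒∣ᵤ n∣A-B | bound
  ... | zero  | _   | _   = refl
  ... | suc m | n∣m | m<n = contradiction m<n (ℕ.≤⇒≯ (ℕ∣.∣⇒≤ n∣m))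

represents-≡ : ∀ {n x y} {a b : Fin n} → x represents a → x ≡ y → y represents b → a ≡ b
represents-≡ p refl q = represents-unique p q

residue : ∀ n .{{_ : NonZero n}} (x : ℤ) → ∃[ a ] _represents_ {n} x a
residue n x = (x %ᶻ n) mod n , represents-cong
  (divides (x /ᶻ n) (trans (cong (_-ᶻ + (x %ᶻ n)) (a≡a%ℕn+[a/ℕn]*n x n))
                           (identity (+ (x %ᶻ n)) (x /ᶻ n *ᶻ + n))))
  (mod-represents (x %ᶻ n) n)
  where
  identity : ∀ x y → x +ᶻ y -ᶻ x ≡ y
  identity = solve-∀

-- Units and divisibility modulo a prime power

*-pres-∣ : ∀ {a b x y} → a ∣ x → b ∣ y → a *ᶻ b ∣ x *ᶻ y
*-pres-∣ {a} {b} (divides q refl) (divides r refl) = divides (q *ᶻ r) (identity q a r b)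
  where
  identity : ∀ q a r b → q *ᶻ a *ᶻ (r *ᶻ b) ≡ q *ᶻ r *ᶻ (a *ᶻ b)
  identity = solve-∀

1∣ : ∀ x → 1ℤ ∣ x
1∣ x = divides x (sym (ℤ.*-identityʳ x))

module _ {p} (p-prime : Prime p) where

  coprime-to : ∀ {x} → ¬ + p ∣ x → Coprime p ∣ x ∣
  coprime-to p∤x (d∣p , d∣x) with prime⇒irreducible p-prime d∣p
  ... | inj₁ d≡1  = d≡1
  ... | inj₂ refl = contradiction (∣ᵤ⇒∣ d∣x) p∤x

  -- Bézout for p and ∣x∣; the factor s with ∣x∣ = s x turns the coefficient of ∣x∣ into one of x.
  -- The two cases differ in the side of the Bézout equation that carries the 1.
  inverse-mod-prime : ∀ x → ¬ + p ∣ x → ∃[ c ] + p ∣ 1ℤ -ᶻ x *ᶻ c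
  inverse-mod-prime x p∤x with m∣∣m∣ {x} | coprime-Bézout (coprime-to p∤x)
  ... | divides s ∣x∣≡sx | Bézout.+- u v eq =
    s *ᶻ (0ℤ -ᶻ + v) , divides (+ u) (begin
      1ℤ -ᶻ x *ᶻ (s *ᶻ (0ℤ -ᶻ + v))  ≡⟨ identity x s (+ v) ⟩
      1ℤ +ᶻ + v *ᶻ (s *ᶻ x)          ≡⟨ cong (λ z → 1ℤ +ᶻ + v *ᶻ z) ∣x∣≡sx ⟨
      1ℤ +ᶻ + v *ᶻ + ∣ x ∣           ≡⟨ cong (1ℤ +ᶻ_) (ℤ.pos-* v ∣ x ∣) ⟨
      + (1 + v * ∣ x ∣)              ≡⟨ cong +_ eq ⟩
      + (u * p)                      ≡⟨ ℤ.pos-* u p ⟩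
      + u *ᶻ + p                     ∎)
    where
    open ≡-Reasoning
    identity : ∀ x s v → 1ℤ -ᶻ x *ᶻ (s *ᶻ (0ℤ -ᶻ v)) ≡ 1ℤ +ᶻ v *ᶻ (s *ᶻ x)
    identity = solve-∀
  ... | divides s ∣x∣≡sx | Bézout.-+ u v eq =
    s *ᶻ + v , divides (0ℤ -ᶻ + u) (begin
      1ℤ -ᶻ x *ᶻ (s *ᶻ + v)          ≡⟨ identity x s (+ v) ⟩
      1ℤ -ᶻ + v *ᶻ (s *ᶻ x)          ≡⟨ cong (λ z → 1ℤ -ᶻ + v *ᶻ z) ∣x∣≡sx ⟨
      1ℤ -ᶻ + v *ᶻ + ∣ x ∣           ≡⟨ cong (1ℤ -ᶻ_) (ℤ.pos-* v ∣ x ∣) ⟨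
      1ℤ -ᶻ + (v * ∣ x ∣)            ≡⟨ cong (λ z → 1ℤ -ᶻ + z) eq ⟨
      1ℤ -ᶻ (1ℤ +ᶻ + (u * p))        ≡⟨ cong (λ z → 1ℤ -ᶻ (1ℤ +ᶻ z)) (ℤ.pos-* u p) ⟩
      1ℤ -ᶻ (1ℤ +ᶻ + u *ᶻ + p)       ≡⟨ identity′ (+ u) (+ p) ⟩
      (0ℤ -ᶻ + u) *ᶻ + p             ∎)
    where
    open ≡-Reasoning
    identity : ∀ x s v → 1ℤ -ᶻ x *ᶻ (s *ᶻ v) ≡ 1ℤ -ᶻ v *ᶻ (s *ᶻ x)
    identity = solve-∀
    identity′ : ∀ u p → 1ℤ -ᶻ (1ℤ +ᶻ u *ᶻ p) ≡ (0ℤ -ᶻ u) *ᶻ p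
    identity′ = solve-∀

  -- The product of the defects 1 - xc, a multiple of p, and 1 - xd, a multiple of p^ℓ, is again of
  -- the form 1 - xe, with e = c + d - xcd.
  inverse-mod-power : ∀ ℓ x → ¬ + p ∣ x → ∃[ c ] + (p ^ ℓ) ∣ 1ℤ -ᶻ x *ᶻ c
  inverse-mod-power zero    x _   = 0ℤ , 1∣ _
  inverse-mod-power (suc ℓ) x p∤x
    with c , p∣ ← inverse-mod-prime x p∤x | d , pˡ∣ ← inverse-mod-power ℓ x p∤x =
    c +ᶻ d -ᶻ x *ᶻ c *ᶻ d ,
    subst (_ ∣_) (identity x c d)
      (subst (_∣ _) (sym (ℤ.pos-* p (p ^ ℓ))) (*-pres-∣ p∣ pˡ∣))
    where
    identity : ∀ x c d →
      (1ℤ -ᶻ x *ᶻ c) *ᶻ (1ℤ -ᶻ x *ᶻ d) ≡ 1ℤ -ᶻ x *ᶻ (c +ᶻ d -ᶻ x *ᶻ c *ᶻ d)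
    identity = solve-∀

  multiple-of-unit : ∀ ℓ x y → ¬ + p ∣ x → ∃[ c ] + (p ^ ℓ) ∣ y -ᶻ x *ᶻ c
  multiple-of-unit ℓ x y p∤x with c , pˡ∣ ← inverse-mod-power ℓ x p∤x =
    c *ᶻ y , subst (_ ∣_) (identity x y c) (∣m⇒∣m*n y pˡ∣)
    where
    identity : ∀ x y c → (1ℤ -ᶻ x *ᶻ c) *ᶻ y ≡ y -ᶻ x *ᶻ (c *ᶻ y)
    identity = solve-∀

  scale-by-prime : ∀ ℓ x y c → + (p ^ ℓ) ∣ y -ᶻ x *ᶻ c →
                   + (p ^ suc ℓ) ∣ y *ᶻ + p -ᶻ x *ᶻ + p *ᶻ c
  scale-by-prime ℓ x y c d = subst (_ ∣_) (identity x y c (+ p))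
    (subst (_∣ + p *ᶻ (y -ᶻ x *ᶻ c)) (sym (ℤ.pos-* p (p ^ ℓ))) (*-monoʳ-∣ (+ p) d))
    where
    identity : ∀ x y c p → p *ᶻ (y -ᶻ x *ᶻ c) ≡ y *ᶻ p -ᶻ x *ᶻ p *ᶻ c
    identity = solve-∀

  -- If x or y is prime to p, it is invertible and divides the other. Otherwise p is divided out of
  -- both and the exponent drops by one; modulo 1 everything divides everything.
  divisibility-total-mod-power : ∀ ℓ x y →
    (∃[ c ] + (p ^ ℓ) ∣ y -ᶻ x *ᶻ c) ⊎ (∃[ c ] + (p ^ ℓ) ∣ x -ᶻ y *ᶻ c)
  divisibility-total-mod-power zero    x y = inj₁ (0ℤ , 1∣ _)
  divisibility-total-mod-power (suc ℓ) x y with + p ∣? x | + p ∣? y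
  ... | no p∤x | _ = inj₁ (multiple-of-unit (suc ℓ) x y p∤x)
  ... | yes _ | no p∤y = inj₂ (multiple-of-unit (suc ℓ) y x p∤y)
  ... | yes (divides x′ refl) | yes (divides y′ refl) with divisibility-total-mod-power ℓ x′ y′
  ...   | inj₁ (c , d) = inj₁ (c , scale-by-prime ℓ x′ y′ c d)
  ...   | inj₂ (c , d) = inj₂ (c , scale-by-prime ℓ y′ x′ c d)

-- Normal forms of configurations

infix 4 _∣ᶠ_
record _∣ᶠ_ {n} (a b : Fin n) : Set where
  constructor dividesᶠ
  field
    cofactor : Fin n
    equality : a *ᶠ cofactor ≡ b

open _∣ᶠ_

-- Principal ideals are totally ordered by inclusion; this is what the normal forms use of a prime
-- power modulus.
Chain : ℕ → Set
Chain n = (a b : Fin n) → a ∣ᶠ b ⊎ b ∣ᶠ a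

infix 4 _≈ᶠ_
-- The relation `_∼_` for points given as functions of the index, so that one formula can transform
-- all of them.
_≈ᶠ_ : ∀ {m n} (x y : Fin m → Point n) → Set
x ≈ᶠ y = ∀ i j → x i ·⊥ x j ≡ y i ·⊥ y j

module _ {n} .{{_ : NonZero n}} where

  𝟎 𝟏 : Fin n
  𝟎 = 0 mod n
  𝟏 = 1 mod n

  0ʳ : 0ℤ represents 𝟎
  0ʳ = mod-represents 0 n

  1ʳ : 1ℤ represents 𝟏
  1ʳ = mod-represents 1 n

  congruent⇒∣ᶠ : ∀ {a b : Fin n} c → + n ∣ + toℕ b -ᶻ + toℕ a *ᶻ c → a ∣ᶠ b
  congruent⇒∣ᶠ {a} {b} c n∣ with d , r ← residue n c =
    dividesᶠ d (represents-unique (represents-cong n∣ (⟦ a ⟧ *ʳ r)) ⟦ b ⟧)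

  *-identityʳ : ∀ (a : Fin n) → a *ᶠ 𝟏 ≡ a
  *-identityʳ a = represents-≡ (⟦ a ⟧ *ʳ 1ʳ) (ℤ.*-identityʳ _) ⟦ a ⟧

  *-zeroʳ : ∀ (a : Fin n) → a *ᶠ 𝟎 ≡ 𝟎
  *-zeroʳ a = represents-≡ (⟦ a ⟧ *ʳ 0ʳ) (ℤ.*-zeroʳ (+ toℕ a)) 0ʳ

  ∣ᶠ-refl : ∀ {a : Fin n} → a ∣ᶠ a
  ∣ᶠ-refl {a} = dividesᶠ 𝟏 (*-identityʳ a)

  ∣ᶠ-trans : ∀ {a b c : Fin n} → a ∣ᶠ b → b ∣ᶠ c → a ∣ᶠ c
  ∣ᶠ-trans {a} (dividesᶠ d refl) (dividesᶠ e refl) =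
    dividesᶠ (d *ᶠ e) (represents-≡ (⟦ a ⟧ *ʳ (⟦ d ⟧ *ʳ ⟦ e ⟧))
      (sym (ℤ.*-assoc (+ toℕ a) (+ toℕ d) (+ toℕ e))) (⟦ a ⟧ *ʳ ⟦ d ⟧ *ʳ ⟦ e ⟧))

  ·⊥-self : ∀ (u : Point n) → u ·⊥ u ≡ 𝟎
  ·⊥-self (a , b) = represents-≡ (⟦ a ⟧ *ʳ ⟦ b ⟧ -ʳ ⟦ b ⟧ *ʳ ⟦ a ⟧) (identity (+ toℕ a) (+ toℕ b)) 0ʳ
    where
    identity : ∀ a b → a *ᶻ b -ᶻ b *ᶻ a ≡ 0ℤ
    identity = solve-∀

  e₁-·⊥ : ∀ (a b : Fin n) → (𝟏 , 𝟎) ·⊥ (a , b) ≡ b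
  e₁-·⊥ a b = represents-≡ (1ʳ *ʳ ⟦ b ⟧ -ʳ 0ʳ *ʳ ⟦ a ⟧) (identity (+ toℕ a) (+ toℕ b)) ⟦ b ⟧
    where
    identity : ∀ a b → 1ℤ *ᶻ b -ᶻ 0ℤ *ᶻ a ≡ b
    identity = solve-∀

  -- An element of SL₂ exchanging the coordinates up to sign. It reduces the case of a second
  -- coordinate dividing all others to that of a first one.
  rotate : Point n → Point n
  rotate (a , b) = b , 𝟎 -ᶠ a

  rotate-·⊥ : ∀ u v → u ·⊥ v ≡ rotate u ·⊥ rotate v
  rotate-·⊥ (a , b) (c , d) = represents-≡
    (⟦ a ⟧ *ʳ ⟦ d ⟧ -ʳ ⟦ b ⟧ *ʳ ⟦ c ⟧)
    (identity (+ toℕ a) (+ toℕ b) (+ toℕ c) (+ toℕ d))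
    (⟦ b ⟧ *ʳ (0ʳ -ʳ ⟦ c ⟧) -ʳ (0ʳ -ʳ ⟦ a ⟧) *ʳ ⟦ d ⟧)
    where
    identity : ∀ a b c d → a *ᶻ d -ᶻ b *ᶻ c ≡ b *ᶻ (0ℤ -ᶻ c) -ᶻ (0ℤ -ᶻ a) *ᶻ d
    identity = solve-∀

  ∣ᶠ-negate : ∀ {a b : Fin n} → a ∣ᶠ b → a ∣ᶠ 𝟎 -ᶠ b
  ∣ᶠ-negate {a} (dividesᶠ c refl) = dividesᶠ (𝟎 -ᶠ c) (represents-≡
    (⟦ a ⟧ *ʳ (0ʳ -ʳ ⟦ c ⟧)) (identity (+ toℕ a) (+ toℕ c)) (0ʳ -ʳ ⟦ a ⟧ *ʳ ⟦ c ⟧))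
    where
    identity : ∀ a c → a *ᶻ (0ℤ -ᶻ c) ≡ 0ℤ -ᶻ a *ᶻ c
    identity = solve-∀

  ∣ᶠ-zero : ∀ {a : Fin n} → a ∣ᶠ 𝟎
  ∣ᶠ-zero {a} = dividesᶠ 𝟎 (*-zeroʳ a)

  -- Writing x j = (d aⱼ , d cⱼ) with aᵢ = 1, the configuration (aⱼ , x i ·⊥ x j)
  -- has the same products; the formal transformation behind this is diag(d⁻¹ , d) after SL₂.
  normalise-point : ∀ {m} (x : Fin m → Point n) i →
    (∀ j → proj₁ (x i) ∣ᶠ proj₁ (x j)) → (∀ j → proj₁ (x i) ∣ᶠ proj₂ (x j)) →
    ∃[ y ] x ≈ᶠ y × y i ≡ (𝟏 , 𝟎)
  normalise-point {m} x i d∣₁ d∣₂ = y , x≈y , cong₂ _,_ aᵢ≡1 (·⊥-self (x i))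
    where
    d = proj₁ (x i)
    -- Cofactors are not unique when d is a zero divisor, so the value 1 at i has to be imposed.
    quotient₁ : ∀ j → ∃[ a ] d *ᶠ a ≡ proj₁ (x j) × (i ≡ j → a ≡ 𝟏)
    quotient₁ j with i Fin.≟ j
    ... | yes refl = 𝟏 , *-identityʳ d , λ _ → refl
    ... | no  i≢j  = cofactor (d∣₁ j) , equality (d∣₁ j) , λ i≡j → contradiction i≡j i≢j
    a c : Fin m → Fin n
    a j = proj₁ (quotient₁ j)
    c j = cofactor (d∣₂ j)
    aᵢ≡1 : a i ≡ 𝟏
    aᵢ≡1 = proj₂ (proj₂ (quotient₁ i)) refl
    y : Fin m → Point n
    y j = a j , x i ·⊥ x j
    x≡ : ∀ j → x j ≡ (d *ᶠ a j , d *ᶠ c j)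
    x≡ j = sym (cong₂ _,_ (proj₁ (proj₂ (quotient₁ j))) (equality (d∣₂ j)))
    -- Both sides equal d²(ac′ - ca′); the terms with cᵢ cancel on the right.
    expansion : ∀ d cᵢ a c a′ c′ →
      (d *ᶠ a , d *ᶠ c) ·⊥ (d *ᶠ a′ , d *ᶠ c′) ≡
      (a  , (d , d *ᶠ cᵢ) ·⊥ (d *ᶠ a  , d *ᶠ c )) ·⊥
      (a′ , (d , d *ᶠ cᵢ) ·⊥ (d *ᶠ a′ , d *ᶠ c′))
    expansion d cᵢ a c a′ c′ = represents-≡
      (D *ʳ A *ʳ (D *ʳ C′) -ʳ D *ʳ C *ʳ (D *ʳ A′))
      (identity (+ toℕ d) (+ toℕ cᵢ) (+ toℕ a) (+ toℕ c) (+ toℕ a′) (+ toℕ c′))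
      (A *ʳ (D *ʳ (D *ʳ C′) -ʳ D *ʳ Cᵢ *ʳ (D *ʳ A′)) -ʳ
       (D *ʳ (D *ʳ C) -ʳ D *ʳ Cᵢ *ʳ (D *ʳ A)) *ʳ A′)
      where
      D = ⟦ d ⟧
      Cᵢ = ⟦ cᵢ ⟧
      A = ⟦ a ⟧
      C = ⟦ c ⟧
      A′ = ⟦ a′ ⟧
      C′ = ⟦ c′ ⟧
      identity : ∀ d cᵢ a c a′ c′ →
        d *ᶻ a *ᶻ (d *ᶻ c′) -ᶻ d *ᶻ c *ᶻ (d *ᶻ a′) ≡
        a *ᶻ (d *ᶻ (d *ᶻ c′) -ᶻ d *ᶻ cᵢ *ᶻ (d *ᶻ a′)) -ᶻ
        (d *ᶻ (d *ᶻ c) -ᶻ d *ᶻ cᵢ *ᶻ (d *ᶻ a)) *ᶻ a′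
      identity = solve-∀
    xᵢ≡ : x i ≡ (d , d *ᶠ c i)
    xᵢ≡ = cong (d ,_) (sym (equality (d∣₂ i)))
    x≈y : x ≈ᶠ y
    x≈y j k = trans (cong₂ _·⊥_ (x≡ j) (x≡ k))
      (trans (expansion d (c i) (a j) (c j) (a k) (c k))
             (sym (cong₂ _·⊥_ (cong (a j ,_) (cong₂ _·⊥_ xᵢ≡ (x≡ j)))
                              (cong (a k ,_) (cong₂ _·⊥_ xᵢ≡ (x≡ k))))))

  -- With x j = (aⱼ , β gⱼ), where gᵢ = 0 and gₗ = 1, subtracting aₗ gⱼ from aⱼ clears
  -- the first coordinate of x l; the rational shear behind it would be by aₗ / β.
  clear-coordinate : ∀ {m} (x : Fin m → Point n) i l → i ≢ l → x i ≡ (𝟏 , 𝟎) →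
    (∀ j → proj₂ (x l) ∣ᶠ proj₂ (x j)) →
    ∃[ y ] x ≈ᶠ y × y i ≡ (𝟏 , 𝟎) × proj₁ (y l) ≡ 𝟎
  clear-coordinate {m} x i l i≢l xᵢ≡ β∣ =
    y , x≈y ,
    cong₂ _,_ (trans (cong₂ (λ u v → u -ᶠ α *ᶠ v) (cong proj₁ xᵢ≡) gᵢ≡0) one) (cong proj₂ xᵢ≡) ,
    trans (cong (λ u → α -ᶠ α *ᶠ u) gₗ≡1) cancel
    where
    α = proj₁ (x l)
    β = proj₂ (x l)
    -- Since β need not be a unit, the values 0 at i and 1 at l are again chosen by cases.
    quotient : ∀ j → ∃[ g ] β *ᶠ g ≡ proj₂ (x j) × (i ≡ j → g ≡ 𝟎) × (l ≡ j → g ≡ 𝟏)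
    quotient j with i Fin.≟ j | l Fin.≟ j
    ... | yes refl | _        = 𝟎 , trans (*-zeroʳ β) (sym (cong proj₂ xᵢ≡)) , (λ _ → refl) ,
                                λ l≡i → contradiction (sym l≡i) i≢l
    ... | no  i≢j  | yes refl = 𝟏 , *-identityʳ β , (λ i≡l → contradiction i≡l i≢l) , λ _ → refl
    ... | no  i≢j  | no  l≢j  = cofactor (β∣ j) , equality (β∣ j) ,
                                (λ i≡j → contradiction i≡j i≢j) , λ l≡j → contradiction l≡j l≢j
    a g : Fin m → Fin n
    a j = proj₁ (x j)
    g j = proj₁ (quotient j)
    gᵢ≡0 : g i ≡ 𝟎
    gᵢ≡0 = proj₁ (proj₂ (proj₂ (quotient i))) refl
    gₗ≡1 : g l ≡ 𝟏
    gₗ≡1 = proj₂ (proj₂ (proj₂ (quotient l))) refl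
    one : 𝟏 -ᶠ α *ᶠ 𝟎 ≡ 𝟏
    one = represents-≡ (1ʳ -ʳ ⟦ α ⟧ *ʳ 0ʳ) (identity (+ toℕ α)) 1ʳ
      where
      identity : ∀ a → 1ℤ -ᶻ a *ᶻ 0ℤ ≡ 1ℤ
      identity = solve-∀
    cancel : α -ᶠ α *ᶠ 𝟏 ≡ 𝟎
    cancel = represents-≡ (⟦ α ⟧ -ʳ ⟦ α ⟧ *ʳ 1ʳ) (identity (+ toℕ α)) 0ʳ
      where
      identity : ∀ a → a -ᶻ a *ᶻ 1ℤ ≡ 0ℤ
      identity = solve-∀
    y : Fin m → Point n
    y j = a j -ᶠ α *ᶠ g j , proj₂ (x j)
    shear : ∀ α β a g a′ g′ →
      (a , β *ᶠ g) ·⊥ (a′ , β *ᶠ g′) ≡ (a -ᶠ α *ᶠ g , β *ᶠ g) ·⊥ (a′ -ᶠ α *ᶠ g′ , β *ᶠ g′)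
    shear α β a g a′ g′ = represents-≡
      (A *ʳ (B *ʳ G′) -ʳ B *ʳ G *ʳ A′)
      (identity (+ toℕ α) (+ toℕ β) (+ toℕ a) (+ toℕ g) (+ toℕ a′) (+ toℕ g′))
      ((A -ʳ ⟦ α ⟧ *ʳ G) *ʳ (B *ʳ G′) -ʳ B *ʳ G *ʳ (A′ -ʳ ⟦ α ⟧ *ʳ G′))
      where
      B = ⟦ β ⟧
      A = ⟦ a ⟧
      G = ⟦ g ⟧
      A′ = ⟦ a′ ⟧
      G′ = ⟦ g′ ⟧
      identity : ∀ α β a g a′ g′ →
        a *ᶻ (β *ᶻ g′) -ᶻ β *ᶻ g *ᶻ a′ ≡
        (a -ᶻ α *ᶻ g) *ᶻ (β *ᶻ g′) -ᶻ β *ᶻ g *ᶻ (a′ -ᶻ α *ᶻ g′)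
      identity = solve-∀
    β*g≡ : ∀ j → β *ᶠ g j ≡ proj₂ (x j)
    β*g≡ j = proj₁ (proj₂ (quotient j))
    x≈y : x ≈ᶠ y
    x≈y j k = trans (sym (cong₂ (λ u v → (a j , u) ·⊥ (a k , v)) (β*g≡ j) (β*g≡ k)))
      (trans (shear α β (a j) (g j) (a k) (g k))
             (cong₂ (λ u v → (a j -ᶠ α *ᶠ g j , u) ·⊥ (a k -ᶠ α *ᶠ g k , v)) (β*g≡ j) (β*g≡ k)))

  module _ (chain : Chain n) where

    -- Divisibility is a total preorder by `chain`, so a finite nonempty family has a least element.
    least-divisor : ∀ {m} (f : Fin (suc m) → Fin n) → ∃[ i ] ∀ j → f i ∣ᶠ f j
    least-divisor {zero}  f = zero , λ { zero → ∣ᶠ-refl }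
    least-divisor {suc m} f with i , fᵢ∣ ← least-divisor (λ j → f (suc j)) | chain (f zero) (f (suc i))
    ... | inj₁ f₀∣fᵢ = zero , λ { zero → ∣ᶠ-refl ; (suc j) → ∣ᶠ-trans f₀∣fᵢ (fᵢ∣ j) }
    ... | inj₂ fᵢ∣f₀ = suc i , λ { zero → fᵢ∣f₀ ; (suc j) → fᵢ∣ j }

    -- Of the least first coordinate and the least second coordinate, one divides the other and
    -- therefore every coordinate. If it is the second, `rotate` is applied beforehand.
    normalise-some-point : ∀ {m} (x : Fin (suc m) → Point n) →
      ∃[ i ] ∃[ y ] x ≈ᶠ y × y i ≡ (𝟏 , 𝟎)
    normalise-some-point x =
      let i , d∣₁ = least-divisor (λ j → proj₁ (x j))
          k , d∣₂ = least-divisor (λ j → proj₂ (x j))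
      in case-chain i k d∣₁ d∣₂ (chain (proj₁ (x i)) (proj₂ (x k)))
      where
      case-chain : ∀ i k → (∀ j → proj₁ (x i) ∣ᶠ proj₁ (x j)) → (∀ j → proj₂ (x k) ∣ᶠ proj₂ (x j)) →
        proj₁ (x i) ∣ᶠ proj₂ (x k) ⊎ proj₂ (x k) ∣ᶠ proj₁ (x i) → ∃[ i ] ∃[ y ] x ≈ᶠ y × y i ≡ (𝟏 , 𝟎)
      case-chain i k d∣₁ d∣₂ (inj₁ d∣d′) =
        i , normalise-point x i d∣₁ (λ j → ∣ᶠ-trans d∣d′ (d∣₂ j))
      case-chain i k d∣₁ d∣₂ (inj₂ d′∣d) =
        let y , x≈y , yₖ≡ = normalise-point (λ j → rotate (x j)) k d∣₂
                              (λ j → ∣ᶠ-negate (∣ᶠ-trans d′∣d (d∣₁ j)))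
        in k , y , (λ j l → trans (rotate-·⊥ (x j) (x l)) (x≈y j l)) , yₖ≡

    -- The index missed by `punchIn i` is i itself, where the second coordinate is 0 and hence
    -- divisible by everything.
    divides-second-coordinates : ∀ {m} {y : Fin (suc m) → Point n} i j → y i ≡ (𝟏 , 𝟎) →
      (∀ l → proj₂ (y (punchIn i j)) ∣ᶠ proj₂ (y (punchIn i l))) →
      ∀ l → proj₂ (y (punchIn i j)) ∣ᶠ proj₂ (y l)
    divides-second-coordinates {y = y} i j yᵢ≡ β∣ l with i Fin.≟ l
    ... | yes refl = subst (proj₂ (y (punchIn i j)) ∣ᶠ_) (sym (cong proj₂ yᵢ≡)) ∣ᶠ-zero
    ... | no  i≢l  = subst (λ t → proj₂ (y (punchIn i j)) ∣ᶠ proj₂ (y t)) (punchIn-punchOut i≢l) (β∣ (punchOut i≢l))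

    -- With at least two points one remains besides i. Among the others, the point whose second
    -- coordinate is least for divisibility is cleared; indexing it through `punchIn i` records that
    -- it differs from i.
    normal-form : ∀ {m} (x : Fin (suc (suc m)) → Point n) →
      ∃[ i ] ∃[ j ] ∃[ y ] x ≈ᶠ y × y i ≡ (𝟏 , 𝟎) × proj₁ (y (punchIn i j)) ≡ 𝟎
    normal-form x =
      let i , y , x≈y , yᵢ≡ = normalise-some-point x
          j , β∣ = least-divisor (λ j → proj₂ (y (punchIn i j)))
          z , y≈z , zᵢ≡ , zⱼ≡ = clear-coordinate y i (punchIn i j)
            (λ eq → punchInᵢ≢i i j (sym eq)) yᵢ≡ (divides-second-coordinates {y = y} i j yᵢ≡ β∣)
      in i , j , z , (λ k l → trans (x≈y k l) (y≈z k l)) , zᵢ≡ , zⱼ≡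

-- Residues modulo a prime power

module _ {p} (p-prime : Prime p) (ℓ : ℕ) where

  instance
    power-nonZero : NonZero (p ^ ℓ)
    power-nonZero = ℕ.m^n≢0 p ℓ {{prime⇒nonZero p-prime}}

  power-chain : Chain (p ^ ℓ)
  power-chain a b with divisibility-total-mod-power p-prime ℓ (+ toℕ a) (+ toℕ b)
  ... | inj₁ (c , d) = inj₁ (congruent⇒∣ᶠ c d)
  ... | inj₂ (c , d) = inj₂ (congruent⇒∣ᶠ c d)

  prime-to⇒unit : ∀ {x} {a : Fin (p ^ ℓ)} → x represents a → ¬ + p ∣ x → Unit a
  prime-to⇒unit {x} {a} r p∤x
    with c , d ← inverse-mod-power p-prime ℓ x p∤x
    with b , s ← residue (p ^ ℓ) c =
    b , represents-unique (s *ʳ r) (represents-cong (subst (_ ∣_) (identity x c) (negated d)) (1ʳ {{nonZeroIndex a}})) ,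
        represents-unique (r *ʳ s) (represents-cong (subst (_ ∣_) (identity′ x c) (negated d)) (1ʳ {{nonZeroIndex a}}))
    where
    negated : ∀ {m y} → m ∣ y → m ∣ 0ℤ -ᶻ y
    negated = ∣m∣n⇒∣m-n (divides 0ℤ refl)
    identity : ∀ x c → 0ℤ -ᶻ (1ℤ -ᶻ x *ᶻ c) ≡ c *ᶻ x -ᶻ 1ℤ
    identity = solve-∀
    identity′ : ∀ x c → 0ℤ -ᶻ (1ℤ -ᶻ x *ᶻ c) ≡ x *ᶻ c -ᶻ 1ℤ
    identity′ = solve-∀

  nonunit⇒divisible : ∀ {x} {a : Fin (p ^ ℓ)} → x represents a → ¬ Unit a → + p ∣ x
  nonunit⇒divisible {x} r ¬unit with + p ∣? x
  ... | yes p∣x = p∣x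
  ... | no  p∤x = contradiction (prime-to⇒unit r p∤x) ¬unit

-- Counting equivalence classes

module _ (S : Setoid 0ℓ 0ℓ) where

  open Setoid S using () renaming (Carrier to A; _≈_ to _≋_; sym to ≋-sym; trans to ≋-trans)

  unique-lookup-injective : ∀ {xs : List A} → SetoidUnique.Unique S xs →
    ∀ {i j} → List.lookup xs i ≋ List.lookup xs j → i ≡ j
  unique-lookup-injective (_  ∷ _)   {zero}  {zero}  _  = refl
  unique-lookup-injective (x∉ ∷ _)   {zero}  {suc j} eq = contradiction eq (All.lookup x∉ (∈-lookup j))
  unique-lookup-injective (x∉ ∷ _)   {suc i} {zero}  eq =
    contradiction (≋-sym eq) (All.lookup x∉ (∈-lookup i))
  unique-lookup-injective (_  ∷ xs!) {suc i} {suc j} eq = cong suc (unique-lookup-injective xs! eq)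

  -- Pigeonhole: entries of `xs` sent to the same position of `ys` are equivalent to one entry,
  -- hence to each other.
  unique-length-≤ : ∀ {xs ys : List A} → SetoidUnique.Unique S xs →
    (∀ {x} → x ∈ xs → Any (x ≋_) ys) → length xs ≤ length ys
  unique-length-≤ {xs} {ys} xs! covered = Fin.injective⇒≤ {f = position} position-injective
    where
    occurrence : ∀ i → Any (List.lookup xs i ≋_) ys
    occurrence i = covered (∈-lookup i)
    position : Fin (length xs) → Fin (length ys)
    position i = index (occurrence i)
    position-injective : ∀ {i j} → position i ≡ position j → i ≡ j
    position-injective {i} {j} eq = unique-lookup-injective xs!
      (≋-trans (Any.lookup-index (occurrence i))
        (subst (λ t → List.lookup ys t ≋ List.lookup xs j) (sym eq)
          (≋-sym (Any.lookup-index (occurrence j)))))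

  map-unique : ∀ {B : Set} {f : B → A} {xs} →
    (∀ {x y} → x ∈ xs → f x ≋ f y → x ≡ y) → Unique xs → SetoidUnique.Unique S (map f xs)
  map-unique inj []         = []
  map-unique inj (x∉ ∷ xs!) =
    All.map⁺ (All.map (λ x≢y fx≈fy → x≢y (inj (here refl) fx≈fy)) x∉) ∷
    map-unique (λ x∈ → inj (there x∈)) xs!

∼-setoid : ∀ k n → DecSetoid 0ℓ 0ℓ
∼-setoid k n = record
  { Carrier = Config k n
  ; _≈_ = _∼_
  ; isDecEquivalence = record
    { isEquivalence = record
      { refl  = λ i j → refl
      ; sym   = λ x∼y i j → sym (x∼y i j)
      ; trans = λ x∼y y∼z i j → trans (x∼y i j) (y∼z i j)
      }
    ; _≟_ = _∼?_
    }
  }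

module _ {k n : ℕ} where

  private
    S = DecSetoid.setoid (∼-setoid k n)

  classCount-≤ : ∀ {xs ys : List (Config k n)} →
    (∀ {x} → x ∈ xs → Any (x ∼_) ys) → classCount xs ≤ length ys
  classCount-≤ {xs} covered = unique-length-≤ S (DecUnique.deduplicate-! (∼-setoid k n) xs)
    λ x∈ → covered (∈-deduplicate⁻ _∼?_ xs x∈)

  -- Each entry of `xs` is equivalent to some survivor of the deduplication of `ys`, and
  -- inequivalent entries have different survivors.
  ≤-classCount : ∀ {xs ys : List (Config k n)} → SetoidUnique.Unique S xs →
    (∀ {x} → x ∈ xs → x ∈ ys) → length xs ≤ classCount ys
  ≤-classCount xs! xs⊆ys = unique-length-≤ S xs! λ {x} x∈xs →
    Any.deduplicate⁺ _∼?_ (λ {y} {z} z∼y x∼y → Setoid.trans S {x} {y} {z} x∼y (Setoid.sym S {z} {y} z∼y))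
      (lose (xs⊆ys x∈xs) (Setoid.refl S {x}))

length-cartesianProductWith : ∀ {A B C : Set} (f : A → B → C) xs ys →
  length (cartesianProductWith f xs ys) ≡ length xs * length ys
length-cartesianProductWith f []       ys = refl
length-cartesianProductWith f (x ∷ xs) ys = trans (length-++ (map (f x) ys))
  (cong₂ _+_ (length-map (f x) ys) (length-cartesianProductWith f xs ys))

length-allVecs : ∀ {A : Set} (xs : List A) m → length (allVecs xs m) ≡ length xs ^ m
length-allVecs xs zero    = refl
length-allVecs xs (suc m) = trans (length-cartesianProductWith _∷_ xs (allVecs xs m))
  (cong (length xs *_) (length-allVecs xs m))

length-allFin : ∀ n → length (allFin n) ≡ n
length-allFin n = length-tabulate {n = n} (λ i → i)

∈-allVecs : ∀ {A : Set} {xs : List A} {m} (v : Vec A m) → (∀ i → lookup v i ∈ xs) → v ∈ allVecs xs m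
∈-allVecs []      _  = here refl
∈-allVecs (x ∷ v) v∈ = ∈-cartesianProductWith⁺ _∷_ (v∈ zero) (∈-allVecs v (λ i → v∈ (suc i)))

allVecs-unique : ∀ {A : Set} {xs : List A} → Unique xs → ∀ m → Unique (allVecs xs m)
allVecs-unique xs! zero    = [] ∷ []
allVecs-unique xs! (suc m) = Unique.cartesianProductWith⁺ _∷_ Vec.∷-injective xs! (allVecs-unique xs! m)

allPoints : ∀ n → List (Point n)
allPoints n = cartesianProduct (allFin n) (allFin n)

∈-allConfigs : ∀ {k n} (x : Config k n) → x ∈ allConfigs k n
∈-allConfigs x = ∈-allVecs x λ i → ∈-cartesianProduct⁺ (∈-allFin _) (∈-allFin _)

lookup-insertAt : ∀ {A : Set} {m} (f : Fin (suc m) → A) i {a} (v : Vec A m) →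
  f i ≡ a → (∀ j → f (punchIn i j) ≡ lookup v j) → ∀ j → f j ≡ lookup (insertAt v i a) j
lookup-insertAt f i {a} v fᵢ≡ f≡ j with i Fin.≟ j
... | yes refl = trans fᵢ≡ (sym (Vec.insertAt-lookup v i a))
... | no  i≢j  = subst (λ t → f t ≡ lookup (insertAt v i a) t) (punchIn-punchOut i≢j)
  (trans (f≡ (punchOut i≢j)) (sym (Vec.insertAt-punchIn v i a (punchOut i≢j))))

-- Upper bound: enumeration of normal forms

module _ {n} .{{_ : NonZero n}} (Bs : List (Fin n)) (k : ℕ) where

  -- The point (0,β) is inserted before (1,0), so j counts the places other than i, as in
  -- `normal-form`.
  decode : Fin (suc (suc k)) × Fin (suc k) → Fin n × Vec (Point n) k → Config (suc k) n
  decode (i , j) (β , v) = insertAt (insertAt v j (𝟎 , β)) i (𝟏 , 𝟎)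

  private
    positions = cartesianProduct (allFin (2 + k)) (allFin (1 + k))
    points    = cartesianProduct (allFin n) Bs
    values    = cartesianProduct Bs (allVecs points k)

  -- `Bs` lists the admissible values of the products: all of `Fin n` for the general count, the
  -- multiples of p for bad configurations.
  normalForms : List (Config (suc k) n)
  normalForms = cartesianProductWith decode positions values

  length-normalForms :
    length normalForms ≡ (2 + k) * (1 + k) * (length Bs * (n * length Bs) ^ k)
  length-normalForms = begin
    length normalForms
      ≡⟨ length-cartesianProductWith decode positions values ⟩
    length positions * length values
      ≡⟨ cong₂ _*_ (length-cartesianProductWith _,_ (allFin (2 + k)) (allFin (1 + k)))
                   (length-cartesianProductWith _,_ Bs (allVecs points k)) ⟩
    length (allFin (2 + k)) * length (allFin (1 + k)) * (length Bs * length (allVecs points k))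
      ≡⟨ cong₂ _*_ (cong₂ _*_ (length-allFin (2 + k)) (length-allFin (1 + k)))
                   (cong (length Bs *_) (length-allVecs points k)) ⟩
    (2 + k) * (1 + k) * (length Bs * length points ^ k)
      ≡⟨ cong (λ l → (2 + k) * (1 + k) * (length Bs * l ^ k))
           (trans (length-cartesianProductWith _,_ (allFin n) Bs)
                  (cong (_* length Bs) (length-allFin n))) ⟩
    (2 + k) * (1 + k) * (length Bs * (n * length Bs) ^ k) ∎
    where open ≡-Reasoning

  -- In a normal form with y i = (1,0) the second coordinates are the products y i ·⊥ y j,
  -- so they inherit membership in Bs.
  normalForms-cover : Chain n → (x : Config (suc k) n) →
    (∀ i j → lookup x i ·⊥ lookup x j ∈ Bs) → Any (x ∼_) normalForms
  normalForms-cover chain x products∈ =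
    let i , j , y , x≈y , yᵢ≡ , yⱼ≡ = normal-form chain (lookup x)
        second∈ : ∀ l → proj₂ (y l) ∈ Bs
        second∈ l = subst (_∈ Bs)
          (trans (x≈y i l) (trans (cong (_·⊥ y l) yᵢ≡) (e₁-·⊥ (proj₁ (y l)) (proj₂ (y l)))))
          (products∈ i l)
        β = proj₂ (y (punchIn i j))
        v = tabulate (λ l → y (punchIn i (punchIn j l)))
        y≡ : ∀ l → y l ≡ lookup (decode (i , j) (β , v)) l
        y≡ = lookup-insertAt y i (insertAt v j (𝟎 , β)) yᵢ≡
          (lookup-insertAt (λ l → y (punchIn i l)) j v (cong (_, β) yⱼ≡)
            (λ l → sym (Vec.lookup∘tabulate _ l)))
    in lose
      (∈-cartesianProductWith⁺ decode
        (∈-cartesianProduct⁺ (∈-allFin i) (∈-allFin j))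
        (∈-cartesianProduct⁺ (second∈ (punchIn i j))
          (∈-allVecs v λ l → subst (_∈ points)
            (sym (Vec.lookup∘tabulate (λ l → y (punchIn i (punchIn j l))) l))
            (∈-cartesianProduct⁺ (∈-allFin _) (second∈ (punchIn i (punchIn j l)))))))
      (λ l m → trans (x≈y l m) (cong₂ _·⊥_ (y≡ l) (y≡ m)))

classCount-upper : ∀ {n} .{{_ : NonZero n}} k → Chain n → (Bs : List (Fin n)) →
  ∀ {xs : List (Config (suc k) n)} →
  (∀ {x} → x ∈ xs → ∀ i j → lookup x i ·⊥ lookup x j ∈ Bs) →
  classCount xs ≤ (2 + k) * (1 + k) * (length Bs * (n * length Bs) ^ k)
classCount-upper k chain Bs products∈ = ℕ.≤-trans
  (classCount-≤ λ {x} x∈ → normalForms-cover Bs k chain x (products∈ x∈))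
  (ℕ.≤-reflexive (length-normalForms Bs k))

-- Lower bound: configurations beginning with (1,0), (0,u)

units : ∀ n → List (Fin n)
units n = filter unit? (allFin n)

∈-units⁻ : ∀ {n} {u : Fin n} → u ∈ units n → Unit u
∈-units⁻ {n} u∈ = proj₂ (∈-filter⁻ unit? {xs = allFin n} u∈)

module _ {n} .{{_ : NonZero n}} (k : ℕ) where

  extend-basis : Fin n → Vec (Point n) k → Config (suc k) n
  extend-basis u v = (𝟏 , 𝟎) ∷ (𝟎 , u) ∷ v

  extend-basis-good : ∀ {u} v → Unit u → Good (extend-basis u v)
  extend-basis-good {u} v unit = zero , suc zero , subst Unit (sym (e₁-·⊥ 𝟎 u)) unit

  -- The product is -ua, so negating it and multiplying by the inverse w of u recovers a.
  second-·⊥-injective : ∀ {u} → Unit u → ∀ b {a a′} →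
    (𝟎 , u) ·⊥ (a , b) ≡ (𝟎 , u) ·⊥ (a′ , b) → a ≡ a′
  second-·⊥-injective {u} (w , _ , u*w≡1) b {a} {a′} eq =
    trans (sym (recover a)) (trans (cong (λ z → (𝟎 -ᶠ z) *ᶠ w) eq) (recover a′))
    where
    recover : ∀ a → (𝟎 -ᶠ (𝟎 , u) ·⊥ (a , b)) *ᶠ w ≡ a
    recover a = trans
      (represents-≡ ((0ʳ -ʳ (0ʳ *ʳ ⟦ b ⟧ -ʳ ⟦ u ⟧ *ʳ ⟦ a ⟧)) *ʳ ⟦ w ⟧)
        (identity (+ toℕ u) (+ toℕ a) (+ toℕ b) (+ toℕ w))
        (⟦ a ⟧ *ʳ (⟦ u ⟧ *ʳ ⟦ w ⟧)))
      (trans (cong (a *ᶠ_) u*w≡1) (*-identityʳ {{nonZeroIndex u}} a))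
      where
      identity : ∀ u a b w → (0ℤ -ᶻ (0ℤ *ᶻ b -ᶻ u *ᶻ a)) *ᶻ w ≡ a *ᶻ (u *ᶻ w)
      identity = solve-∀

  -- Products with (1,0) reveal u and every second coordinate; products with (0,u) then reveal the
  -- first coordinates.
  extend-basis-injective : ∀ {u u′ v v′} → Unit u →
    extend-basis u v ∼ extend-basis u′ v′ → u ≡ u′ × v ≡ v′
  extend-basis-injective {u} {u′} {v} {v′} unit eq = u≡u′ , v≡v′
    where
    second-coordinates : ∀ a b a′ b′ → (𝟏 , 𝟎) ·⊥ (a , b) ≡ (𝟏 , 𝟎) ·⊥ (a′ , b′) → b ≡ b′
    second-coordinates a b a′ b′ eq = trans (sym (e₁-·⊥ a b)) (trans eq (e₁-·⊥ a′ b′))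
    u≡u′ : u ≡ u′
    u≡u′ = second-coordinates 𝟎 u 𝟎 u′ (eq zero (suc zero))
    point≡ : ∀ a b a′ b′ → b ≡ b′ → (𝟎 , u) ·⊥ (a , b) ≡ (𝟎 , u) ·⊥ (a′ , b′) → (a , b) ≡ (a′ , b′)
    point≡ a b a′ .b refl eq₂ = cong (_, b) (second-·⊥-injective unit b {a} {a′} eq₂)
    lookup≡ : ∀ i → lookup v i ≡ lookup v′ i
    lookup≡ i = point≡ (proj₁ s) (proj₂ s) (proj₁ t) (proj₂ t)
      (second-coordinates (proj₁ s) (proj₂ s) (proj₁ t) (proj₂ t) (eq zero (suc (suc i))))
      (trans (eq (suc zero) (suc (suc i))) (cong (λ z → (𝟎 , z) ·⊥ t) (sym u≡u′)))
      where
      s = lookup v i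
      t = lookup v′ i
    v≡v′ : v ≡ v′
    v≡v′ = trans (sym (Vec.tabulate∘lookup v))
      (trans (Vec.tabulate-cong lookup≡) (Vec.tabulate∘lookup v′))

  private
    tails = allVecs (allPoints n) k

  basis-extensions : List (Config (suc k) n)
  basis-extensions = map (λ s → extend-basis (proj₁ s) (proj₂ s)) (cartesianProduct (units n) tails)

  length-basis-extensions : length basis-extensions ≡ length (units n) * (n * n) ^ k
  length-basis-extensions = begin
    length basis-extensions
      ≡⟨ length-map _ (cartesianProduct (units n) tails) ⟩
    length (cartesianProduct (units n) tails)
      ≡⟨ length-cartesianProductWith _,_ (units n) tails ⟩
    length (units n) * length tails
      ≡⟨ cong (length (units n) *_) (length-allVecs (allPoints n) k) ⟩
    length (units n) * length (allPoints n) ^ k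
      ≡⟨ cong (λ l → length (units n) * l ^ k)
           (trans (length-cartesianProductWith _,_ (allFin n) (allFin n))
                  (cong₂ _*_ (length-allFin n) (length-allFin n))) ⟩
    length (units n) * (n * n) ^ k ∎
    where open ≡-Reasoning

  extend-basis-injective-on-units : ∀ {s t} → s ∈ cartesianProduct (units n) tails →
    extend-basis (proj₁ s) (proj₂ s) ∼ extend-basis (proj₁ t) (proj₂ t) → s ≡ t
  extend-basis-injective-on-units {u , v} {u′ , v′} s∈ eq =
    let u≡u′ , v≡v′ = extend-basis-injective {u} {u′} {v} {v′}
                        (∈-units⁻ (proj₁ (∈-cartesianProduct⁻ (units n) tails s∈))) eq
    in cong₂ _,_ u≡u′ v≡v′

  basis-extensions-unique :
    SetoidUnique.Unique (DecSetoid.setoid (∼-setoid (suc k) n)) basis-extensions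
  basis-extensions-unique = map-unique (DecSetoid.setoid (∼-setoid (suc k) n))
    {f = λ s → extend-basis (proj₁ s) (proj₂ s)} (λ {s} {t} → extend-basis-injective-on-units {s} {t})
    (Unique.cartesianProduct⁺ (Unique.filter⁺ unit? (Unique.allFin⁺ n))
      (allVecs-unique (Unique.cartesianProduct⁺ (Unique.allFin⁺ n) (Unique.allFin⁺ n)) k))

  extend-basis-good-on-units : ∀ s → s ∈ cartesianProduct (units n) tails →
    Good (extend-basis (proj₁ s) (proj₂ s))
  extend-basis-good-on-units (u , v) s∈ =
    extend-basis-good {u} v (∈-units⁻ {u = u} (proj₁ (∈-cartesianProduct⁻ (units n) tails s∈)))

  basis-extensions-good : ∀ {x} → x ∈ basis-extensions → Good x
  basis-extensions-good {x} x∈ =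
    let s , s∈ , x≡ = ∈-map⁻ (λ s → extend-basis (proj₁ s) (proj₂ s)) x∈
    in subst Good {extend-basis (proj₁ s) (proj₂ s)} {x} (sym x≡) (extend-basis-good-on-units s s∈)

  classCount-lower : ∀ {ys : List (Config (suc k) n)} → (∀ {x} → Good x → x ∈ ys) →
    length (units n) * (n * n) ^ k ≤ classCount ys
  classCount-lower good∈ = ℕ.≤-trans (ℕ.≤-reflexive (sym length-basis-extensions))
    (≤-classCount basis-extensions-unique λ x∈ → good∈ (basis-extensions-good x∈))

-- The proportion of units

module _ {p} (p-prime : Prime p) (ℓ : ℕ) where

  private
    n = p ^ ℓ
    instance
      n-nonZero : NonZero n
      n-nonZero = power-nonZero p-prime ℓ

  -- A nonunit a is a multiple of p; if 1 - a were one too, p would divide their sum 1.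
  nonunit⇒complement-unit : ∀ (a : Fin n) → ¬ Unit a → Unit (𝟏 -ᶠ a)
  nonunit⇒complement-unit a ¬unit = prime-to⇒unit p-prime ℓ {1ℤ -ᶻ + toℕ a} (1ʳ -ʳ ⟦ a ⟧) λ p∣1-a →
    contradiction
      (ℕ∣.∣1⇒≡1 (∣⇒∣ᵤ (subst (+ p ∣_) (identity (+ toℕ a))
        (∣m∣n⇒∣m+n p∣1-a (nonunit⇒divisible p-prime ℓ ⟦ a ⟧ ¬unit)))))
      (ℕ.nonTrivial⇒≢1 {{prime⇒nonTrivial p-prime}})
    where
    identity : ∀ a → 1ℤ -ᶻ a +ᶻ a ≡ 1ℤ
    identity = solve-∀

  complement-injective : ∀ {a b : Fin n} → 𝟏 -ᶠ a ≡ 𝟏 -ᶠ b → a ≡ b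
  complement-injective {a} {b} eq =
    trans (sym (involutive a)) (trans (cong (𝟏 -ᶠ_) eq) (involutive b))
    where
    involutive : ∀ (a : Fin n) → 𝟏 -ᶠ (𝟏 -ᶠ a) ≡ a
    involutive a = represents-≡ (1ʳ -ʳ (1ʳ -ʳ ⟦ a ⟧)) (identity (+ toℕ a)) ⟦ a ⟧
      where
      identity : ∀ a → 1ℤ -ᶻ (1ℤ -ᶻ a) ≡ a
      identity = solve-∀

  -- Of a and 1 - a at least one is a unit, so a ↦ a or 1 - a is at most two-to-one onto units.
  to-unit : Fin n → Fin n × Bool
  to-unit a with unit? a
  ... | yes _ = a , true
  ... | no  _ = 𝟏 -ᶠ a , false

  to-unit-injective : ∀ {a b} → to-unit a ≡ to-unit b → a ≡ b
  to-unit-injective {a} {b} eq with unit? a | unit? b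
  ... | yes _ | yes _ = cong proj₁ eq
  ... | no  _ | no  _ = complement-injective (cong proj₁ eq)
  ... | yes _ | no  _ with () ← cong proj₂ eq
  ... | no  _ | yes _ with () ← cong proj₂ eq

  to-unit-unit : ∀ a → Unit (proj₁ (to-unit a))
  to-unit-unit a with unit? a
  ... | yes unit  = unit
  ... | no  ¬unit = nonunit⇒complement-unit a ¬unit

  at-least-half-units : n ≤ length (units n) * 2
  at-least-half-units = begin
    n                            ≡⟨ length-allFin n ⟨
    length (allFin n)            ≡⟨ length-map to-unit (allFin n) ⟨
    length (map to-unit (allFin n))
      ≤⟨ unique-length-≤ (setoid (Fin n × Bool)) (Unique.map⁺ to-unit-injective (Unique.allFin⁺ n)) covered ⟩
    length (cartesianProduct (units n) (true ∷ false ∷ []))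
      ≡⟨ length-cartesianProductWith _,_ (units n) (true ∷ false ∷ []) ⟩
    length (units n) * 2     ∎
    where
    open ℕ.≤-Reasoning
    bool∈ : ∀ b → b ∈ (true ∷ false ∷ [])
    bool∈ true  = here refl
    bool∈ false = there (here refl)
    covered : ∀ {x} → x ∈ map to-unit (allFin n) → x ∈ cartesianProduct (units n) (true ∷ false ∷ [])
    covered x∈ with a , _ , refl ← ∈-map⁻ to-unit x∈ =
      ∈-cartesianProduct⁺ (∈-filter⁺ unit? (∈-allFin _) (to-unit-unit a)) (bool∈ _)

-- Upper bound for bad configurations

module _ {p} (p-prime : Prime p) (ℓ : ℕ) where

  private
    M = p ^ ℓ
    n = p ^ suc ℓ
    instance
      n-nonZero : NonZero n
      n-nonZero = power-nonZero p-prime (suc ℓ)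

  -- Written as qp with q below p^ℓ, while the modulus is p^(ℓ+1), so that the length p^ℓ is
  -- immediate.
  multiples : List (Fin n)
  multiples = map (λ (q : Fin M) → (toℕ q * p) mod n) (allFin M)

  length-multiples : length multiples ≡ M
  length-multiples = trans (length-map _ (allFin M)) (length-allFin M)

  ∈-multiples : ∀ (a : Fin n) → + p ∣ + toℕ a → a ∈ multiples
  ∈-multiples a p∣a with ∣⇒∣ᵤ p∣a
  ... | ℕ∣.divides q a≡qp = subst (_∈ multiples) residue≡a (∈-map⁺ _ (∈-allFin (fromℕ< q<M)))
    where
    q<M : q < M
    q<M = ℕ.*-cancelʳ-< p q M (begin-strict
      q * p   ≡⟨ a≡qp ⟨
      toℕ a   <⟨ toℕ<n a ⟩
      p * M   ≡⟨ ℕ.*-comm p M ⟩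
      M * p   ∎)
      where open ℕ.≤-Reasoning
    residue≡a : (toℕ (fromℕ< q<M) * p) mod n ≡ a
    residue≡a = represents-≡ (mod-represents (toℕ (fromℕ< q<M) * p) n)
      (cong +_ (trans (cong (_* p) (toℕ-fromℕ< q<M)) (sym a≡qp))) ⟦ a ⟧

  -- In a bad configuration every product is a nonunit, hence a multiple of p, so `multiples` can
  -- serve as `Bs`.
  bad-upper : ∀ k → #𝒞-bad (suc k) n ≤ (2 + k) * (1 + k) * (M * (n * M) ^ k)
  bad-upper k = subst (λ l → #𝒞-bad (suc k) n ≤ (2 + k) * (1 + k) * (l * (n * l) ^ k)) length-multiples
    (classCount-upper k (power-chain p-prime (suc ℓ)) multiples
      λ {x} x∈ i j → ∈-multiples (lookup x i ·⊥ lookup x j)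
        (nonunit⇒divisible p-prime (suc ℓ) ⟦ lookup x i ·⊥ lookup x j ⟧
          λ unit → proj₂ (∈-filter⁻ bad? {xs = allConfigs (suc k) n} x∈) (i , j , unit)))

-- Comparison with the power of exponent 2k - 1

odd-power : ∀ n k → n * (n * n) ^ k ≡ n ^ (2 * suc k ∸ 1)
odd-power n k = begin
  n * (n * n) ^ k        ≡⟨ cong (λ m → n * (n * m) ^ k) (ℕ.*-identityʳ n) ⟨
  n * (n ^ 2) ^ k        ≡⟨ cong (n *_) (ℕ.^-*-assoc n 2 k) ⟩
  -- `2 * suc k ∸ 1` computes to `k + suc (k + 0)`; only the successor has to be moved.
  n * n ^ (2 * k)        ≡⟨ cong (n ^_) (ℕ.+-suc k (k + 0)) ⟨
  n ^ (2 * suc k ∸ 1)    ∎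
  where open ≡-Reasoning

-- The number of pairs (i, j) of places in a normal form with k + 2 points. Being at least 2, it
-- also absorbs the factor lost in passing to units.
constant : ℕ → ℕ
constant k = (2 + k) * (1 + k)

-- The bound of `bad-upper` has k + 1 factors M = n/p. One of them absorbs p, since `p * M` is n;
-- the others are weakened to n.
bad-decay : ∀ {p} → Prime p → ∀ ℓ k →
  p * #𝒞-bad (suc k) (p ^ suc ℓ) ≤ constant k * (p ^ suc ℓ) ^ (2 * suc k ∸ 1)
bad-decay {p} p-prime ℓ k = begin
  p * #𝒞-bad (suc k) n                 ≤⟨ ℕ.*-monoʳ-≤ p (bad-upper p-prime ℓ k) ⟩
  p * (K * (M * (n * M) ^ k))          ≡⟨ rearrange p K M ((n * M) ^ k) ⟩
  K * (n * (n * M) ^ k)                ≤⟨ ℕ.*-monoʳ-≤ K (ℕ.*-monoʳ-≤ n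
                                            (ℕ.^-monoˡ-≤ k (ℕ.*-monoʳ-≤ n M≤n))) ⟩
  K * (n * (n * n) ^ k)                ≡⟨ cong (K *_) (odd-power n k) ⟩
  K * n ^ (2 * suc k ∸ 1)              ∎
  where
  open ℕ.≤-Reasoning
  K = constant k
  M = p ^ ℓ
  n = p ^ suc ℓ
  M≤n : M ≤ n
  M≤n = ℕ.m≤n*m M p {{prime⇒nonZero p-prime}}
  rearrange : ∀ p K M m → p * (K * (M * m)) ≡ K * (p * M * m)
  rearrange = ℕ-solve-∀

-- Asking that `ys` contain the good configurations lets one argument treat both the list of all
-- configurations and the list of good ones.
class-bounds : ∀ {p} → Prime p → ∀ ℓ k (ys : List (Config (suc k) (p ^ ℓ))) →
  (∀ {x} → Good x → x ∈ ys) →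
  (p ^ ℓ) ^ (2 * suc k ∸ 1) ≤ constant k * classCount ys ×
  classCount ys ≤ constant k * (p ^ ℓ) ^ (2 * suc k ∸ 1)
class-bounds {p} p-prime ℓ k ys good∈ = lower , upper
  where
  open ℕ.≤-Reasoning
  n = p ^ ℓ
  instance
    n-nonZero : NonZero n
    n-nonZero = power-nonZero p-prime ℓ
  K = constant k
  lower : n ^ (2 * suc k ∸ 1) ≤ K * classCount ys
  lower = begin
    n ^ (2 * suc k ∸ 1)                    ≡⟨ odd-power n k ⟨
    n * (n * n) ^ k                        ≤⟨ ℕ.*-monoˡ-≤ ((n * n) ^ k) (at-least-half-units p-prime ℓ) ⟩
    length (units n) * 2 * (n * n) ^ k     ≡⟨ rearrange (length (units n)) ((n * n) ^ k) ⟩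
    2 * (length (units n) * (n * n) ^ k)   ≤⟨ ℕ.*-mono-≤ 2≤K (classCount-lower k good∈) ⟩
    K * classCount ys                      ∎
    where
    2≤K : 2 ≤ K
    2≤K = ℕ.≤-trans (ℕ.m≤m+n 2 k) (ℕ.m≤m*n (2 + k) (1 + k))
    rearrange : ∀ u m → u * 2 * m ≡ 2 * (u * m)
    rearrange = ℕ-solve-∀
  upper : classCount ys ≤ K * n ^ (2 * suc k ∸ 1)
  upper = begin
    classCount ys              ≤⟨ classCount-upper k (power-chain p-prime ℓ) (allFin n) {ys} (λ _ i j → ∈-allFin _) ⟩
    K * (length (allFin n) * (n * length (allFin n)) ^ k)
                               ≡⟨ cong (λ l → K * (l * (n * l) ^ k)) (length-allFin n) ⟩
    K * (n * (n * n) ^ k)      ≡⟨ cong (K *_) (odd-power n k) ⟩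
    K * n ^ (2 * suc k ∸ 1)    ∎

-- Passage to rational ε

-- A positive ε has numerator at least 1, so ε is at least the reciprocal of its denominator.
-- Unnormalised rationals reduce the claim to cross multiplication.
ℕ→ℚ-≤-* : ∀ {X Y} (ε : ℚ) → 0ℚ ℚ.< ε → ℚ.↧ₙ ε * X ≤ Y → ℕ→ℚ X ℚ.≤ ε ℚ.* ℕ→ℚ Y
ℕ→ℚ-≤-* {X} {Y} ε@(mkℚ (+ suc e) d-1 _) _ dX≤Y = ℚ.toℚᵘ-cancel-≤
  (ℚᵘ.≤-respˡ-≃ (ℚᵘ.≃-sym (ℚ.toℚᵘ-fromℚᵘ x))
    (ℚᵘ.≤-respʳ-≃ (ℚᵘ.≃-sym (ℚᵘ.≃-trans (ℚ.toℚᵘ-homo-* ε (ℕ→ℚ Y))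
                              (ℚᵘ.*-congˡ {toℚᵘ ε} (ℚ.toℚᵘ-fromℚᵘ y))))
      (ℚᵘ.*≤* cross)))
  where
  x = ℚᵘ.mkℚᵘ (+ X) 0
  y = ℚᵘ.mkℚᵘ (+ Y) 0
  cross : ℚᵘ.↥ x *ᶻ ℚᵘ.↧ (toℚᵘ ε ℚᵘ.* y) ≤ᶻ ℚᵘ.↥ (toℚᵘ ε ℚᵘ.* y) *ᶻ ℚᵘ.↧ x
  cross = ℤ.≤-trans (ℤ.≤-reflexive (sym (ℤ.pos-* X (suc (d-1 * 1)))))
    (ℤ.≤-trans (+≤+ natural)
      (ℤ.≤-reflexive (trans (ℤ.pos-* (suc e) Y) (sym (ℤ.*-identityʳ (+ suc e *ᶻ + Y))))))
    where
    natural : X * suc (d-1 * 1) ≤ suc e * Y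
    natural = begin
      X * suc (d-1 * 1)  ≡⟨ cong (λ d → X * suc d) (ℕ.*-identityʳ d-1) ⟩
      X * suc d-1        ≡⟨ ℕ.*-comm X (suc d-1) ⟩
      suc d-1 * X        ≤⟨ dX≤Y ⟩
      Y                  ≤⟨ ℕ.m≤n*m Y (suc e) ⟩
      suc e * Y          ∎
      where open ℕ.≤-Reasoning
ℕ→ℚ-≤-* (mkℚ (+ 0) _ _) (ℚ.*<* (+<+ ()))
ℕ→ℚ-≤-* (mkℚ -[1+ _ ] _ _) (ℚ.*<* ())

bad-isLittleO : ∀ k → IsLittleO (λ p ℓ → #𝒞-bad (suc k) (p ^ ℓ)) (λ p ℓ → (p ^ ℓ) ^ (2 * suc k ∸ 1))
-- For p at least dK, `bad-decay` gives K(dX) ≤ pX ≤ KY, where X is the bad count and Y the power;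
-- cancelling K leaves dX ≤ Y.
bad-isLittleO k ε 0<ε = d * K , bound
  where
  d = ℚ.↧ₙ ε
  K = constant k
  bound : ∀ p ℓ → OddPrime p → 1 ≤ ℓ → d * K ≤ p →
    ℕ→ℚ (#𝒞-bad (suc k) (p ^ ℓ)) ℚ.≤ ε ℚ.* ℕ→ℚ ((p ^ ℓ) ^ (2 * suc k ∸ 1))
  -- `1 ≤ ℓ` leaves the successor case, in which a factor p can be split off the modulus.
  bound p (suc ℓ) (p-prime , _) _ dK≤p = ℕ→ℚ-≤-* ε 0<ε (ℕ.*-cancelˡ-≤ K (begin
    K * (d * X)  ≡⟨ rearrange K d X ⟩
    d * K * X    ≤⟨ ℕ.*-monoˡ-≤ X dK≤p ⟩
    p * X        ≤⟨ bad-decay p-prime ℓ k ⟩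
    K * (p ^ suc ℓ) ^ (2 * suc k ∸ 1) ∎))
    where
    open ℕ.≤-Reasoning
    X = #𝒞-bad (suc k) (p ^ suc ℓ)
    rearrange : ∀ K d X → K * (d * X) ≡ d * K * X
    rearrange = ℕ-solve-∀

theorem6p1 : (k : ℕ) → 1 ≤ k →
    ((λ p ℓ → #𝒞 k (p ^ ℓ)) ≈ (λ p ℓ → (p ^ ℓ) ^ (2 * k ∸ 1)))
    × ((λ p ℓ → #𝒞-good k (p ^ ℓ)) ≈ (λ p ℓ → (p ^ ℓ) ^ (2 * k ∸ 1)))
    × IsLittleO (λ p ℓ → #𝒞-bad k (p ^ ℓ)) (λ p ℓ → (p ^ ℓ) ^ (2 * k ∸ 1))
theorem6p1 (suc k) _ =
  (constant k , s≤s z≤n , λ p ℓ (p-prime , _) _ →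
    class-bounds p-prime ℓ k (allConfigs (suc k) (p ^ ℓ)) (λ {x} _ → ∈-allConfigs x)) ,
  (constant k , s≤s z≤n , λ p ℓ (p-prime , _) _ →
    class-bounds p-prime ℓ k (filter good? (allConfigs (suc k) (p ^ ℓ)))
      (λ {x} good → ∈-filter⁺ good? (∈-allConfigs x) good)) ,
  bad-isLittleO k
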